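{- For every positive integer $n$ and every symmetrizable $n\times n$ integer matrix $A=(a_{ij})$, the algorithm SymmetrizerMatrix (described in the context) is correct: on input $A$ it terminates and returns a diagonal matrix $D=\mathrm{diag}(d_{11},\dots,d_{nn})$ with positive diagonal entries such that $D\times A$ is symmetric.
   Context: A square integer matrix $A$ is symmetrizable if there is a diagonal real matrix $D$ with positive diagonal entries such that $D\times A$ is symmetric; such a $D$ is called a symmetrizer of $A$. Algorithm SymmetrizerMatrix($A$), for $A$ a symmetrizable $n\times n$ integer matrix: (1) Set $d_{ii}\leftarrow 0$ for all $i\in\{1,\dots,n\}$; let $S$ be the set $\{1,\dots,n\}$ and let $T$ be the ordered list $(1,\dots,n)$. (2) While $S\neq\varnothing$: let $i$ be the first element of $T$ and remove $i$ from $T$. If $d_{ii}=0$, set $d_{ii}\leftarrow 1$ and remove $i$ from $S$. Then, for each $j$ in $T$ (traversing each element that is in $T$ at the start of this inner loop exactly once): if $a_{ji}\neq 0$, move $j$ to the first position of $T$ and, if moreover $d_{jj}=0$, set $d_{jj}\leftarrow d_{ii}a_{ij}/a_{ji}$ and remove $j$ from $S$. (3) When $S$ is empty, return the diagonal matrix $D$ with diagonal entries $d_{11},\dots,d_{nn}$. -}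

module Defs where

open import Level using (0ℓ)
open import Algebra.Bundles using (RawSemiring)
import Algebra.Definitions.RawMonoid as RawMonoidDefs
open import Data.Nat.Base as ℕ using (ℕ)
import Data.Nat.Properties as ℕ
open import Data.Integer.Base using (ℤ; 0ℤ)
import Data.Integer.Properties as ℤ
open import Data.Rational.Base hiding (+-rawMonoid; +-0-rawMonoid)
open import Data.Rational.Literals using (fromℤ)
open import Data.Rational.Properties hiding (+-rawMonoid)
open import Data.Rational.Solver using (module +-*-Solver)
open import Data.Fin.Base using (Fin)
import Data.Fin.Properties as Fin
open import Data.Fin.Subset as Subset using (Subset; Empty; Nonempty)
open import Data.List.Base using (List; []; _∷_; allFin; filter; foldl)
open import Data.Vec.Functional using (Vector; replicate; updateAt; map)
open import Data.Product.Base using (∃-syntax; _×_; _,_; proj₁; proj₂)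
open import Function.Base using (const)
open import Relation.Nullary using (yes; no; ¬?)
open import Relation.Binary.PropositionalEquality using (_≡_; _≢_; refl; sym; trans; cong; subst)

Matrix : Set → ℕ → Set
Matrix A n = Vector (Vector A n) n

module MatrixOver (R : RawSemiring 0ℓ 0ℓ) where
  open RawSemiring R using (Carrier; _≈_; +-rawMonoid; 0#) renaming (_*_ to _·_)
  open RawMonoidDefs +-rawMonoid using (sum)

  infixl 7 _⊗_

  _⊗_ : ∀ {n} → Matrix Carrier n → Matrix Carrier n → Matrix Carrier n
  (M ⊗ N) i j = sum λ k → M i k · N k j

  diag : ∀ {n} → Vector Carrier n → Matrix Carrier n
  diag d i j with i Fin.≟ j
  ... | yes _ = d i
  ... | no  _ = 0#

  IsSymmetric : ∀ {n} → Matrix Carrier n → Set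
  IsSymmetric M = ∀ i j → M i j ≈ M j i

------------------------------------------------------------------------
-- Real numbers: Cauchy sequences of rationals, with equality the setoid
-- relation _≃_ (the difference tends to 0).

Eventually : (ℕ → Set) → Set
Eventually P = ∃[ N ] (∀ m → N ℕ.≤ m → P m)

IsCauchy : (ℕ → ℚ) → Set
IsCauchy x = ∀ ε → 0ℚ < ε →
  ∃[ N ] (∀ m n → N ℕ.≤ m → N ℕ.≤ n → ∣ x m - x n ∣ < ε)

record ℝ : Set where
  constructor mkℝ
  field
    seq    : ℕ → ℚ
    cauchy : IsCauchy seq

open ℝ public

infix 4 _≃ᴿ_

_≃ᴿ_ : ℝ → ℝ → Set
x ≃ᴿ y = ∀ ε → 0ℚ < ε → Eventually λ m → ∣ seq x m - seq y m ∣ < ε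

-- A Cauchy sequence has a positive limit iff it is eventually bounded
-- below by a positive rational; positivity of every term would be
-- neither necessary nor sufficient.
Positiveᴿ : ℝ → Set
Positiveᴿ x = ∃[ ε ] (0ℚ < ε × Eventually λ m → ε < seq x m)

private
  halve : ∀ ε → 0ℚ < ε → ∃[ h ] (0ℚ < h × h + h ≡ ε)
  halve ε 0<ε = ½ * ε
    , subst (_< ½ * ε) (*-zeroʳ ½) (*-monoʳ-<-pos ½ {0ℚ} {ε} 0<ε)
    , trans (sym (*-distribʳ-+ ε ½ ½)) (*-identityˡ ε)

  divide : ∀ h P → 0ℚ < h → 0ℚ < P → ∃[ δ ] (0ℚ < δ × P * δ ≡ h)
  divide h P 0<h 0<P = 1/P * h
    , positive⁻¹ (1/P * h) {{pos*pos⇒pos 1/P {{1/pos⇒pos P {{P>0}}}} h {{positive 0<h}}}}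
    , trans (sym (*-assoc P 1/P h))
        (trans (cong (_* h) (*-inverseʳ P {{pos⇒nonZero P {{P>0}}}})) (*-identityˡ h))
    where
    P>0 : Positive P
    P>0 = positive 0<P
    1/P : ℚ
    1/P = (1/ P) {{pos⇒nonZero P {{P>0}}}}

  ∣+∣-bound : ∀ p q h → ∣ p ∣ < h → ∣ q ∣ < h → ∣ p + q ∣ < h + h
  ∣+∣-bound p q h hp hq = ≤-<-trans (∣p+q∣≤∣p∣+∣q∣ p q)
    (+-mono-< {∣ p ∣} {h} {∣ q ∣} {h} hp hq)

  ∣*∣-bound : ∀ p q P δ → 0ℚ < P → ∣ p ∣ < P → ∣ q ∣ < δ → ∣ p * q ∣ < P * δ
  ∣*∣-bound p q P δ 0<P hp hq = subst (_< P * δ) (sym (∣p*q∣≡∣p∣*∣q∣ p q))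
    (≤-<-trans
      (*-monoʳ-≤-nonNeg ∣ q ∣ {{∣-∣-nonNeg q}} {∣ p ∣} {P} (<⇒≤ hp))
      (*-monoʳ-<-pos P {{positive 0<P}} {∣ q ∣} {δ} hq))

  open +-*-Solver

  sum-diff : ∀ a b c d → (a - c) + (b - d) ≡ (a + b) - (c + d)
  sum-diff = solve 4 (λ a b c d → (a :- c) :+ (b :- d) := (a :+ b) :- (c :+ d)) refl

  prod-diff : ∀ a b c d → a * (b - d) + d * (a - c) ≡ a * b - c * d
  prod-diff = solve 4 (λ a b c d → a :* (b :- d) :+ d :* (a :- c) := a :* b :- c :* d) refl

  cancel-diff : ∀ a b → a - b + b ≡ a
  cancel-diff = solve 2 (λ a b → a :- b :+ b := a) refl

  Close : (ℕ → ℚ) → ℚ → Set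
  Close x ε = ∃[ N ] (∀ m n → N ℕ.≤ m → N ℕ.≤ n → ∣ x m - x n ∣ < ε)

  Bound : (ℕ → ℚ) → Set
  Bound x = ∃[ B ] (0ℚ < B × Eventually λ m → ∣ x m ∣ < B)

  bounded : ∀ x → Close x 1ℚ → Bound x
  bounded x (N , close) = 1ℚ + ∣ x N ∣
    , <-≤-trans (positive⁻¹ 1ℚ) (subst (_≤ 1ℚ + ∣ x N ∣) (+-identityʳ 1ℚ)
        (+-monoʳ-≤ 1ℚ {0ℚ} {∣ x N ∣} (0≤∣p∣ (x N))))
    , N , λ m N≤m → ≤-<-trans
        (subst (λ z → ∣ z ∣ ≤ ∣ x m - x N ∣ + ∣ x N ∣) (cancel-diff (x m) (x N))
          (∣p+q∣≤∣p∣+∣q∣ (x m - x N) (x N)))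
        (+-monoˡ-< ∣ x N ∣ {∣ x m - x N ∣} {1ℚ} (close m N N≤m ℕ.≤-refl))

  +-close : ∀ x y h → Close x h → Close y h → Close (λ m → x m + y m) (h + h)
  +-close x y h (M , px) (N , py) = M ℕ.⊔ N , λ m n M⊔N≤m M⊔N≤n →
    subst (λ z → ∣ z ∣ < h + h) (sum-diff (x m) (y m) (x n) (y n))
      (∣+∣-bound (x m - x n) (y m - y n) h
        (px m n (ℕ.m⊔n≤o⇒m≤o M N M⊔N≤m) (ℕ.m⊔n≤o⇒m≤o M N M⊔N≤n))
        (py m n (ℕ.m⊔n≤o⇒n≤o M N M⊔N≤m) (ℕ.m⊔n≤o⇒n≤o M N M⊔N≤n)))

  *-close : ∀ x y h → 0ℚ < h → IsCauchy x → IsCauchy y → Bound x → Bound y →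
            Close (λ m → x m * y m) (h + h)
  *-close x y h 0<h cx cy (B , 0<B , K , bx) (C , 0<C , L , by) =
    go (divide h C 0<h 0<C) (divide h B 0<h 0<B)
    where
    go : ∃[ δ ] (0ℚ < δ × C * δ ≡ h) → ∃[ δ ] (0ℚ < δ × B * δ ≡ h) →
         Close (λ m → x m * y m) (h + h)
    go (δ , 0<δ , Cδ≡h) (η , 0<η , Bη≡h) = close (cx δ 0<δ) (cy η 0<η)
      where
      close : Close x δ → Close y η → Close (λ m → x m * y m) (h + h)
      close (M , px) (N , py) = (K ℕ.⊔ L) ℕ.⊔ (M ℕ.⊔ N) , λ m n ≤m ≤n →
        let MN≤m = ℕ.m⊔n≤o⇒n≤o (K ℕ.⊔ L) (M ℕ.⊔ N) ≤m
            MN≤n = ℕ.m⊔n≤o⇒n≤o (K ℕ.⊔ L) (M ℕ.⊔ N) ≤n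
            K≤m  = ℕ.m⊔n≤o⇒m≤o K L (ℕ.m⊔n≤o⇒m≤o (K ℕ.⊔ L) (M ℕ.⊔ N) ≤m)
            L≤n  = ℕ.m⊔n≤o⇒n≤o K L (ℕ.m⊔n≤o⇒m≤o (K ℕ.⊔ L) (M ℕ.⊔ N) ≤n)
        in subst (λ z → ∣ z ∣ < h + h) (prod-diff (x m) (y m) (x n) (y n))
          (∣+∣-bound (x m * (y m - y n)) (y n * (x m - x n)) h
            (subst (∣ x m * (y m - y n) ∣ <_) Bη≡h
              (∣*∣-bound (x m) (y m - y n) B η 0<B (bx m K≤m)
                (py m n (ℕ.m⊔n≤o⇒n≤o M N MN≤m) (ℕ.m⊔n≤o⇒n≤o M N MN≤n))))
            (subst (∣ y n * (x m - x n) ∣ <_) Cδ≡h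
              (∣*∣-bound (y n) (x m - x n) C δ 0<C (by n L≤n)
                (px m n (ℕ.m⊔n≤o⇒m≤o M N MN≤m) (ℕ.m⊔n≤o⇒m≤o M N MN≤n)))))

+-cauchy : ∀ x y → IsCauchy x → IsCauchy y → IsCauchy (λ m → x m + y m)
+-cauchy x y cx cy ε 0<ε = go (halve ε 0<ε)
  where
  go : ∃[ h ] (0ℚ < h × h + h ≡ ε) → Close (λ m → x m + y m) ε
  go (h , 0<h , h+h≡ε) =
    subst (Close (λ m → x m + y m)) h+h≡ε (+-close x y h (cx h 0<h) (cy h 0<h))

*-cauchy : ∀ x y → IsCauchy x → IsCauchy y → IsCauchy (λ m → x m * y m)
*-cauchy x y cx cy ε 0<ε = go (halve ε 0<ε)
  where
  go : ∃[ h ] (0ℚ < h × h + h ≡ ε) → Close (λ m → x m * y m) ε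
  go (h , 0<h , h+h≡ε) = subst (Close (λ m → x m * y m)) h+h≡ε
    (*-close x y h 0<h cx cy
      (bounded x (cx 1ℚ (positive⁻¹ 1ℚ))) (bounded y (cy 1ℚ (positive⁻¹ 1ℚ))))

fromℚᴿ : ℚ → ℝ
fromℚᴿ q = mkℝ (const q) λ ε 0<ε → 0 , λ _ _ _ _ →
  subst (λ z → ∣ z ∣ < ε) (sym (+-inverseʳ q)) 0<ε

ℝ-rawSemiring : RawSemiring 0ℓ 0ℓ
ℝ-rawSemiring = record
  { Carrier = ℝ
  ; _≈_     = _≃ᴿ_
  ; _+_     = λ x y → mkℝ (λ m → seq x m + seq y m) (+-cauchy (seq x) (seq y) (cauchy x) (cauchy y))
  ; _*_     = λ x y → mkℝ (λ m → seq x m * seq y m) (*-cauchy (seq x) (seq y) (cauchy x) (cauchy y))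
  ; 0#      = fromℚᴿ 0ℚ
  ; 1#      = fromℚᴿ 1ℚ
  }

------------------------------------------------------------------------

module Mℝ = MatrixOver ℝ-rawSemiring
module Mℚ = MatrixOver +-*-rawSemiring

fromℤᴿ : ℤ → ℝ
fromℤᴿ a = fromℚᴿ (fromℤ a)

Symmetrizable : ∀ {n} → Matrix ℤ n → Set
Symmetrizable {n} A = ∃[ d ] ((∀ i → Positiveᴿ (d i))
  × Mℝ.IsSymmetric {n} (Mℝ.diag d Mℝ.⊗ map (map fromℤᴿ) A))

------------------------------------------------------------------------
-- The algorithm SymmetrizerMatrix.  Its arithmetic is exact: starting
-- from 0 and 1 it only multiplies and divides by integers, so the d i
-- are rational.

record State (n : ℕ) : Set where
  constructor ⟨_,_,_⟩
  field
    d : Vector ℚ n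
    S : Subset n
    T : List (Fin n)

open State public

initial : ∀ n → State n
initial n = ⟨ replicate n 0ℚ , Subset.⊤ , allFin n ⟩

assign : ∀ {n} → Fin n → ℚ → State n → State n
assign i q s = ⟨ updateAt (d s) i (const q) , S s Subset.- i , T s ⟩

assignIfZero : ∀ {n} → Fin n → ℚ → State n → State n
assignIfZero i q s with d s i ≟ 0ℚ
... | yes _ = assign i q s
... | no  _ = s

moveToFront : ∀ {n} → Fin n → State n → State n
moveToFront j s = ⟨ d s , S s , j ∷ filter (λ k → ¬? (k Fin.≟ j)) (T s) ⟩

fromℤ-nonZero : ∀ {a} → a ≢ 0ℤ → NonZero (fromℤ a)
fromℤ-nonZero {a} a≢0 = ≢-nonZero {fromℤ a} λ eq → a≢0 (cong ↥_ eq)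

visit : ∀ {n} → Matrix ℤ n → Fin n → State n → Fin n → State n
visit A i s j with A j i ℤ.≟ 0ℤ
... | yes _     = s
... | no aⱼᵢ≢0 = assignIfZero j
  (_÷_ (d s i * fromℤ (A i j)) (fromℤ (A j i)) {{fromℤ-nonZero aⱼᵢ≢0}})
  (moveToFront j s)

-- One pass of the while loop, with i the head of T and T′ its tail.
-- The list traversed is T′ as it stands when the inner loop starts, so
-- the moves made during the traversal do not affect it.
pass : ∀ {n} → Matrix ℤ n → State n → Fin n → List (Fin n) → State n
pass A s i T′ =
  foldl (visit A i) (assignIfZero i 1ℚ ⟨ d s , S s , T′ ⟩) T′

-- A ⊢ s ⇓ D: the while loop on input A, entered in state s, terminates
-- and returns D.  At most one rule applies to any state and each is
-- deterministic, so a derivation is the unique run from s.  No rule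
-- applies when S is nonempty and T is empty: taking the first element
-- of T would then fail.
infix 4 _⊢_⇓_

data _⊢_⇓_ {n} (A : Matrix ℤ n) : State n → Matrix ℚ n → Set where
  stop : ∀ {s} → Empty (S s) → A ⊢ s ⇓ Mℚ.diag (d s)
  loop : ∀ {s i T′ D} → Nonempty (S s) → T s ≡ i ∷ T′ →
         A ⊢ pass A s i T′ ⇓ D → A ⊢ s ⇓ D

SymmetrizerMatrix_returns_ : ∀ {n} → Matrix ℤ n → Matrix ℚ n → Set
SymmetrizerMatrix_returns_ {n} A D = A ⊢ initial n ⇓ D

{-# OPTIONS --safe #-}
module Submission where

open import Defs
open import Data.Nat.Base using (ℕ; NonZero)
open import Data.Integer.Base using (ℤ)
open import Data.Rational.Base using (ℚ; 0ℚ; _<_)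
open import Data.Vec.Functional using (Vector; map)
open import Data.Rational.Literals using (fromℤ)
open import Data.Product.Base using (∃-syntax; _×_)
open import Relation.Binary.PropositionalEquality using (_≡_)

open import Algebra.Bundles using (RawSemiring; CommutativeRing)
import Algebra.Definitions.RawMonoid as RawMonoid
import Algebra.Properties.Semiring.Sum as SemiringSum
open import Data.Fin.Base using (Fin; zero; suc)
import Data.Fin.Properties as Fin
open import Data.Fin.Subset as Subset using (Subset; _∉_)
open import Data.Fin.Subset.Properties using (x∈p∧x≢y⇒x∈p-y; p─q⊆p; nonempty?; ∈⊤)
open import Data.Integer.Base using (0ℤ)
import Data.Integer.Properties as ℤ
open import Data.List.Base using (List; []; _∷_; length; foldl)
open import Data.List.Membership.Propositional using (_∈_)
open import Data.List.Membership.Propositional.Properties using (∈-filter⁺; ∈-filter⁻; ∈-allFin)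
open import Data.List.Properties using (filter-notAll; length-tabulate)
open import Data.List.Relation.Binary.Subset.Propositional using (_⊆_)
open import Data.List.Relation.Binary.Subset.Propositional.Properties using (∷⁺ʳ)
open import Data.List.Relation.Unary.All as All using (All; []; _∷_)
import Data.List.Relation.Unary.All.Properties as All
open import Data.List.Relation.Unary.AllPairs as AllPairs using (AllPairs; []; _∷_)
import Data.List.Relation.Unary.AllPairs.Properties as AllPairs
open import Data.List.Relation.Unary.Any as Any using (here; there)
open import Data.List.Relation.Unary.Unique.Propositional.Properties using (allFin⁺)
import Data.Nat.Base as ℕ
import Data.Nat.Properties as ℕ
open import Data.Product.Base using (_,_; proj₁; proj₂)
open import Data.Rational.Base as ℚ hiding (+-rawMonoid; +-0-rawMonoid; NonZero)
open import Data.Rational.Properties hiding (+-rawMonoid)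
open import Data.Rational.Solver using (module +-*-Solver)
open import Data.Sum.Base as Sum using (_⊎_; inj₁; inj₂)
open import Data.Vec.Base using (_∷_; there)
open import Data.Vec.Functional using (updateAt)
open import Data.Vec.Functional.Properties using (updateAt-updates; updateAt-minimal)
open import Function.Base using (const; _∘_)
open import Relation.Binary.Definitions using (Tri; tri<; tri≈; tri>)
open import Relation.Binary.PropositionalEquality
  using (_≢_; refl; sym; trans; cong; cong₂; subst; subst₂)
open import Relation.Nullary using (¬_; ¬?; Dec; yes; no; contradiction)

-- Let e be the given real symmetrizer.  The entries assigned within one connected
-- component of the graph of A stay proportional to e.  Every visited neighbour is
-- assigned and moved to the front, so in T the assigned indices precede the unassigned
-- ones, and an index removed from T has no unassigned neighbour except during its own
-- pass.  Hence the assigned neighbours of a newly assigned j are still in T or equal to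
-- the current i, where all assigned entries are proportional to e, and an unassigned
-- head of T starts a new component.  The pass from i shortens T, and indices outside
-- T are assigned, so the loop stops with S empty.

-- Rational sequences up to a vanishing difference, and their rational multiples.

module _ where
  open +-*-Solver

  swap : ∀ a b → - (a - b) ≡ b - a
  swap = solve 2 (λ a b → :- (a :- b) := b :- a) refl

  telescope : ∀ a b c → (a - b) + (b - c) ≡ a - c
  telescope = solve 3 (λ a b c → (a :- b) :+ (b :- c) := a :- c) refl

  factor : ∀ a b c → a * b - a * c ≡ a * (b - c)
  factor = solve 3 (λ a b c → a :* b :- a :* c := a :* (b :- c)) refl

  restore : ∀ a b → a + (b - a) ≡ b
  restore = solve 2 (λ a b → a :+ (b :- a) := b) refl

  split : ∀ a b c → a * c + (b - a) * c ≡ b * c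
  split = solve 3 (λ a b c → a :* c :+ (b :- a) :* c := b :* c) refl

p≤∣p∣ : ∀ p → p ≤ ∣ p ∣
p≤∣p∣ p with ≤-total 0ℚ p
... | inj₁ 0≤p = ≤-reflexive (sym (0≤p⇒∣p∣≡p 0≤p))
... | inj₂ p≤0 = ≤-trans p≤0 (0≤∣p∣ p)

infix 4 _≈_
infixr 8 _∙_

-- This is `_≃ᴿ_` on the underlying sequences; scaling by rationals then carries no Cauchy proofs
-- along.
_≈_ : (ℕ → ℚ) → (ℕ → ℚ) → Set
x ≈ y = ∀ ε → 0ℚ < ε → Eventually λ m → ∣ x m - y m ∣ < ε

EventuallyPositive : (ℕ → ℚ) → Set
EventuallyPositive x = ∃[ ε ] (0ℚ < ε × Eventually λ m → ε < x m)

_∙_ : ℚ → (ℕ → ℚ) → ℕ → ℚ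
(q ∙ x) m = q * x m

≗⇒≈ : ∀ {x y} → (∀ m → x m ≡ y m) → x ≈ y
≗⇒≈ {x} {y} x≗y ε 0<ε = 0 , λ m _ →
  subst (λ z → ∣ z ∣ < ε) (sym (trans (cong (_- y m) (x≗y m)) (+-inverseʳ (y m)))) 0<ε

≈-sym : ∀ {x y} → x ≈ y → y ≈ x
≈-sym {x} {y} x≈y ε 0<ε = let N , close = x≈y ε 0<ε in N , λ m N≤m → subst (_< ε)
  (trans (sym (∣-p∣≡∣p∣ (x m - y m))) (cong ∣_∣ (swap (x m) (y m)))) (close m N≤m)

≈-trans : ∀ {x y z} → x ≈ y → y ≈ z → x ≈ z
≈-trans {x} {y} {z} x≈y y≈z ε 0<ε = M ℕ.⊔ N , λ m M⊔N≤m →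
  subst₂ _<_ (cong ∣_∣ (telescope (x m) (y m) (z m))) (halves ε)
    (≤-<-trans (∣p+q∣≤∣p∣+∣q∣ (x m - y m) (y m - z m))
      (+-mono-< {∣ x m - y m ∣} {½ * ε} {∣ y m - z m ∣} {½ * ε}
        (proj₂ (x≈y (½ * ε) 0<½ε) m (ℕ.m⊔n≤o⇒m≤o M N M⊔N≤m))
        (proj₂ (y≈z (½ * ε) 0<½ε) m (ℕ.m⊔n≤o⇒n≤o M N M⊔N≤m))))
  where
  0<½ε : 0ℚ < ½ * ε
  0<½ε = positive⁻¹ (½ * ε) {{pos*pos⇒pos ½ ε {{positive 0<ε}}}}
  M = proj₁ (x≈y (½ * ε) 0<½ε)
  N = proj₁ (y≈z (½ * ε) 0<½ε)
  halves : ∀ a → ½ * a + ½ * a ≡ a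
  halves a = trans (sym (*-distribʳ-+ a ½ ½)) (*-identityˡ a)

-- Supplies the modulus of continuity for multiplication by `r`. The summand 1 in `B` keeps it
-- invertible when `r` is zero.
dilate : ∀ r ε → 0ℚ < ε → ∃[ B ] ∃[ δ ] (∣ r ∣ ≤ B × 0ℚ < B × 0ℚ < δ × B * δ ≡ ε)
dilate r ε 0<ε = B , 1/ B * ε
  , subst (_≤ B) (+-identityˡ ∣ r ∣) (+-monoˡ-≤ ∣ r ∣ (<⇒≤ (positive⁻¹ 1ℚ)))
  , positive⁻¹ B
  , positive⁻¹ (1/ B * ε) {{pos*pos⇒pos (1/ B) {{1/pos⇒pos B}} ε {{positive 0<ε}}}}
  , trans (sym (*-assoc B (1/ B) ε)) (trans (cong (_* ε) (*-inverseʳ B)) (*-identityˡ ε))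
  where
  B = 1ℚ + ∣ r ∣
  instance
    B>0 : Positive B
    B>0 = pos+nonNeg⇒pos 1ℚ ∣ r ∣ {{∣-∣-nonNeg r}}
    B≢0 : ℚ.NonZero B
    B≢0 = pos⇒nonZero B

∙-cong : ∀ r {x y} → x ≈ y → r ∙ x ≈ r ∙ y
∙-cong r {x} {y} x≈y ε 0<ε = go (dilate r ε 0<ε)
  where
  open ≤-Reasoning
  go : ∃[ B ] ∃[ δ ] (∣ r ∣ ≤ B × 0ℚ < B × 0ℚ < δ × B * δ ≡ ε) →
       Eventually λ m → ∣ r * x m - r * y m ∣ < ε
  go (B , δ , ∣r∣≤B , 0<B , 0<δ , Bδ≡ε) =
    let N , close = x≈y δ 0<δ in N , λ m N≤m → begin-strict
      ∣ r * x m - r * y m ∣  ≡⟨ cong ∣_∣ (factor r (x m) (y m)) ⟩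
      ∣ r * (x m - y m) ∣    ≡⟨ ∣p*q∣≡∣p∣*∣q∣ r (x m - y m) ⟩
      ∣ r ∣ * ∣ x m - y m ∣  ≤⟨ *-monoʳ-≤-nonNeg ∣ x m - y m ∣ {{∣-∣-nonNeg (x m - y m)}} {∣ r ∣} {B} ∣r∣≤B ⟩
      B * ∣ x m - y m ∣      <⟨ *-monoʳ-<-pos B {{positive 0<B}} {∣ x m - y m ∣} {δ} (close m N≤m) ⟩
      B * δ                  ≡⟨ Bδ≡ε ⟩
      ε                      ∎

∙-scale : ∀ r {p q x y} → p ∙ x ≈ q ∙ y → (r * p) ∙ x ≈ (r * q) ∙ y
∙-scale r {p} {q} {x} {y} px≈qy =
  ≈-trans {(r * p) ∙ x} {r ∙ p ∙ x} {(r * q) ∙ y} (≗⇒≈ {(r * p) ∙ x} {r ∙ p ∙ x} λ m → *-assoc r p (x m))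
  (≈-trans {r ∙ p ∙ x} {r ∙ q ∙ y} {(r * q) ∙ y} (∙-cong r {p ∙ x} {q ∙ y} px≈qy)
  (≗⇒≈ {r ∙ q ∙ y} {(r * q) ∙ y} λ m → sym (*-assoc r q (y m))))

-- At an index past both thresholds, closeness within `δ` contradicts a gap of `δ`. The comparisons
-- of limits below reduce to this.
≈⇒¬gap : ∀ {x y δ} → x ≈ y → 0ℚ < δ → ¬ Eventually (λ m → x m + δ ≤ y m)
≈⇒¬gap {x} {y} {δ} x≈y 0<δ (M , gap) = <⇒≢ b<a+δ (≤-antisym (<⇒≤ b<a+δ) (gap m (ℕ.m≤m⊔n M N)))
  where
  y≈x : y ≈ x
  y≈x = ≈-sym {x} {y} x≈y
  N = proj₁ (y≈x δ 0<δ)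
  m = M ℕ.⊔ N
  a = x m
  b = y m
  b<a+δ : b < a + δ
  b<a+δ = subst (_< a + δ) (restore a b)
    (+-monoʳ-< a {b - a} {δ} (≤-<-trans {b - a} {∣ b - a ∣} {δ} (p≤∣p∣ (b - a))
      (proj₂ (y≈x δ 0<δ) m (ℕ.m≤n⊔m M N))))

-- If `p` were at most zero, the left side would eventually be at most zero while the right side
-- stays above `q * η`, which is a gap.
∙-pos : ∀ {p q x y} → EventuallyPositive x → EventuallyPositive y → p ∙ x ≈ q ∙ y → 0ℚ < q → 0ℚ < p
∙-pos {p} {q} {x} {y} (ε , 0<ε , M , x>ε) (η , 0<η , N , y>η) px≈qy 0<q = go (0ℚ <? p)
  where
  open ≤-Reasoning
  gap : p ≤ 0ℚ → ∀ m → M ℕ.≤ m → N ℕ.≤ m → p * x m + q * η ≤ q * y m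
  gap p≤0 m M≤m N≤m = begin
    p * x m + q * η   ≤⟨ +-monoˡ-≤ (q * η) {p * x m} {0ℚ * x m} (*-monoʳ-≤-nonNeg (x m)
                           {{nonNegative (<⇒≤ (<-trans {0ℚ} {ε} {x m} 0<ε (x>ε m M≤m)))}} {p} {0ℚ} p≤0) ⟩
    0ℚ * x m + q * η  ≡⟨ cong (_+ q * η) (*-zeroˡ (x m)) ⟩
    0ℚ + q * η        ≡⟨ +-identityˡ (q * η) ⟩
    q * η             ≤⟨ <⇒≤ (*-monoʳ-<-pos q {{positive 0<q}} {η} {y m} (y>η m N≤m)) ⟩
    q * y m           ∎
  go : Dec (0ℚ < p) → 0ℚ < p
  go (yes 0<p) = 0<p
  go (no  0≮p) = contradiction
    (M ℕ.⊔ N , λ m M⊔N≤m → gap (≮⇒≥ 0≮p) m (ℕ.m⊔n≤o⇒m≤o M N M⊔N≤m) (ℕ.m⊔n≤o⇒n≤o M N M⊔N≤m))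
    (≈⇒¬gap {p ∙ x} {q ∙ y} px≈qy (positive⁻¹ (q * η) {{pos*pos⇒pos q {{positive 0<q}} η {{positive 0<η}}}}))

∙-mono-≉ : ∀ {p q x} → EventuallyPositive x → p < q → ¬ p ∙ x ≈ q ∙ x
∙-mono-≉ {p} {q} {x} (ε , 0<ε , M , x>ε) p<q px≈qx = ≈⇒¬gap {p ∙ x} {q ∙ x} px≈qx
  (positive⁻¹ ((q - p) * ε) {{pos*pos⇒pos (q - p) {{positive 0<q-p}} ε {{positive 0<ε}}}})
  (M , gap)
  where
  0<q-p : 0ℚ < q - p
  0<q-p = subst (_< q - p) (+-inverseʳ p) (+-monoˡ-< (- p) {p} {q} p<q)
  open ≤-Reasoning
  gap : ∀ m → M ℕ.≤ m → p * x m + (q - p) * ε ≤ q * x m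
  gap m M≤m = begin
    p * x m + (q - p) * ε    ≤⟨ +-monoʳ-≤ (p * x m) {(q - p) * ε} {(q - p) * x m}
                                  (<⇒≤ (*-monoʳ-<-pos (q - p) {{positive 0<q-p}} {ε} {x m} (x>ε m M≤m))) ⟩
    p * x m + (q - p) * x m  ≡⟨ split p q (x m) ⟩
    q * x m                  ∎

-- Brings equalities of limits back to exact equalities of rationals: for distinct `p` and `q` the
-- two multiples eventually stay a fixed positive distance apart.
∙-injective : ∀ {p q x} → EventuallyPositive x → p ∙ x ≈ q ∙ x → p ≡ q
∙-injective {p} {q} {x} x>0 px≈qx = go (<-cmp p q)
  where
  go : Tri (p < q) (p ≡ q) (q < p) → p ≡ q
  go (tri< p<q _ _) = contradiction px≈qx (∙-mono-≉ {p} {q} {x} x>0 p<q)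
  go (tri≈ _ p≡q _) = p≡q
  go (tri> _ _ q<p) = contradiction (≈-sym {p ∙ x} {q ∙ x} px≈qx) (∙-mono-≉ {q} {p} {x} x>0 q<p)

-- Products with a diagonal matrix, entry by entry.

open RawMonoid (RawSemiring.+-rawMonoid ℝ-rawSemiring) using () renaming (sum to sumᴿ)
open SemiringSum (CommutativeRing.semiring +-*-commutativeRing) using (sum; sum-cong-≗; sum-replicate-zero)

sum-supported : ∀ {n} (i : Fin n) {t : Vector ℚ n} → (∀ k → k ≢ i → t k ≡ 0ℚ) → sum t ≡ t i
sum-supported {ℕ.suc n} zero {t} off = trans
  (cong (t zero +_) (trans (sum-cong-≗ λ k → off (suc k) λ ()) (sum-replicate-zero n)))
  (+-identityʳ (t zero))
sum-supported (suc i) {t} off = trans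
  (cong₂ _+_ (off zero λ ()) (sum-supported i λ k k≢i → off (suc k) (k≢i ∘ Fin.suc-injective)))
  (+-identityˡ (t (suc i)))

diag-⊗ : ∀ {n} (d : Vector ℚ n) (M : Matrix ℚ n) i j → (Mℚ.diag d Mℚ.⊗ M) i j ≡ d i * M i j
diag-⊗ d M i j = trans (sum-supported i off) on
  where
  off : ∀ k → k ≢ i → Mℚ.diag d i k * M k j ≡ 0ℚ
  off k k≢i with i Fin.≟ k
  ... | yes i≡k = contradiction (sym i≡k) k≢i
  ... | no  _   = *-zeroˡ (M k j)
  on : Mℚ.diag d i i * M i j ≡ d i * M i j
  on with i Fin.≟ i
  ... | yes _   = refl
  ... | no  i≢i = contradiction refl i≢i

seq-sum : ∀ {n} (t : Vector ℝ n) m → seq (sumᴿ t) m ≡ sum (λ k → seq (t k) m)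
seq-sum {ℕ.zero}  t m = refl
seq-sum {ℕ.suc n} t m = cong (seq (t zero) m +_) (seq-sum (t ∘ suc) m)

seq-⊗ : ∀ {n} (M N : Matrix ℝ n) i j m → seq ((M Mℝ.⊗ N) i j) m ≡ sum (λ k → seq (M i k) m * seq (N k j) m)
seq-⊗ M N i j m = seq-sum (λ k → RawSemiring._*_ ℝ-rawSemiring (M i k) (N k j)) m

seq-diag : ∀ {n} (e : Vector ℝ n) i k m → seq (Mℝ.diag e i k) m ≡ Mℚ.diag (λ k → seq (e k) m) i k
seq-diag e i k m with i Fin.≟ k
... | yes _ = refl
... | no  _ = refl

-- SymmetricProduct, and the variables P and M below, let the hypothesis of the theorem
-- match syntactically; otherwise Agda would compare the Cauchy proofs inside the entries
-- of the product by normalising them.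
SymmetricProduct : ∀ {n} → Matrix ℝ n → Matrix ℝ n → Set
SymmetricProduct P M = Mℝ.IsSymmetric (P Mℝ.⊗ M)

balance : ∀ {n} (A : Matrix ℤ n) (e : Vector ℝ n) (P M : Matrix ℝ n) →
  Mℝ.diag e ≡ P → map (map fromℤᴿ) A ≡ M → SymmetricProduct P M →
  ∀ i j → fromℤ (A i j) ∙ seq (e i) ≈ fromℤ (A j i) ∙ seq (e j)
balance A e P M diag≡P A≡M symmetric i j ε 0<ε = proj₁ (symmetric i j ε 0<ε) , λ m N≤m →
  subst₂ (λ x y → ∣ x - y ∣ < ε) (entry i j m) (entry j i m) (proj₂ (symmetric i j ε 0<ε) m N≤m)
  where
  term : ∀ i j m k → seq (P i k) m * seq (M k j) m ≡ Mℚ.diag (λ k → seq (e k) m) i k * fromℤ (A k j)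
  term i j m k = cong₂ _*_
    (trans (cong (λ Q → seq (Q i k) m) (sym diag≡P)) (seq-diag e i k m))
    (cong (λ Q → seq (Q k j) m) (sym A≡M))
  entry : ∀ i j m → seq ((P Mℝ.⊗ M) i j) m ≡ fromℤ (A i j) * seq (e i) m
  entry i j m = trans (seq-⊗ P M i j m)
    (trans (sum-cong-≗ {x = λ k → seq (P i k) m * seq (M k j) m}
                       {y = λ k → Mℚ.diag (λ k → seq (e k) m) i k * fromℤ (A k j)} (term i j m))
    (trans (diag-⊗ (λ k → seq (e k) m) (λ k l → fromℤ (A k l)) i j) (*-comm (seq (e i) m) (fromℤ (A i j)))))

∙-cancel : ∀ {p q r x y} → r ≢ 0ℚ → (p * r) ∙ x ≈ (q * r) ∙ y → p ∙ x ≈ q ∙ y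
∙-cancel {p} {q} {r} {x} {y} r≢0 prx≈qry =
  subst₂ (λ s t → s ∙ x ≈ t ∙ y) (cancel p) (cancel q) (∙-scale (1/ r) {p * r} {q * r} {x} {y} prx≈qry)
  where
  instance _ = ≢-nonZero r≢0
  cancel : ∀ s → 1/ r * (s * r) ≡ s
  cancel s = trans (*-comm (1/ r) (s * r)) (trans (*-assoc s r (1/ r))
    (trans (cong (s *_) (*-inverseʳ r)) (*-identityʳ s)))

-- Case analysis of the steps of the algorithm, and their effect on the list.

module _ {n} (A : Matrix ℤ n) where

  -- Opens both tests of `visit` once, so that preservation of an invariant splits into three plain
  -- cases.
  visit-elim : ∀ (P : State n → Set) i s j → (A j i ≡ 0ℤ → P s) →
    (A j i ≢ 0ℤ → d s j ≢ 0ℚ → P (moveToFront j s)) →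
    ((a≢0 : A j i ≢ 0ℤ) → d s j ≡ 0ℚ →
      P (assign j (_÷_ (d s i * fromℤ (A i j)) (fromℤ (A j i)) {{fromℤ-nonZero a≢0}}) (moveToFront j s))) →
    P (visit A i s j)
  visit-elim P i s j skip move set with A j i ℤ.≟ 0ℤ
  ... | yes a≡0 = skip a≡0
  ... | no  a≢0 with d s j ≟ 0ℚ
  ...   | yes d≡0 = set a≢0 d≡0
  ...   | no  d≢0 = move a≢0 d≢0

assignIfZero-elim : ∀ {n} (P : State n → Set) i q s →
  (d s i ≢ 0ℚ → P s) → (d s i ≡ 0ℚ → P (assign i q s)) → P (assignIfZero i q s)
assignIfZero-elim P i q s skip set with d s i ≟ 0ℚ
... | yes d≡0 = set d≡0
... | no  d≢0 = skip d≢0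

x∉p-x : ∀ {n} (p : Subset n) x → x ∉ p Subset.- x
x∉p-x (_ ∷ p) (suc x) (there x∈p-x) = x∉p-x p x x∈p-x

-- T has no duplicates, and its assigned indices (those with d k ≢ 0ℚ) come first.
Ordered : ∀ {n} → Vector ℚ n → List (Fin n) → Set
Ordered d = AllPairs λ k l → k ≢ l × (d k ≡ 0ℚ → d l ≡ 0ℚ)

module _ {n} {d d′ : Vector ℚ n} {j} (agree : ∀ k → k ≢ j → d′ k ≡ d k) where

  ordered-agree : ∀ {ks} → All (_≢ j) ks → Ordered d ks → Ordered d′ ks
  ordered-agree []           []              = []
  ordered-agree (k≢j ∷ ks≢j) (k<ks ∷ ordered) =
    All.zipWith (λ { (l≢j , k≢l , dk⇒dl) → k≢l , λ d′k≡0 →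
      trans (agree _ l≢j) (dk⇒dl (trans (sym (agree _ k≢j)) d′k≡0)) }) (ks≢j , k<ks)
    ∷ ordered-agree ks≢j ordered

  -- The new head `j` is assigned in `d′`, so what the ordering asks of zeros behind it is vacuous;
  -- the rest is a sublist without `j`, where `d` and `d′` agree. With `d′` equal to `d` this covers
  -- a mere move.
  ordered-moveToFront : ∀ {S ks} → d′ j ≢ 0ℚ → Ordered d ks → Ordered d′ (T (moveToFront j ⟨ d , S , ks ⟩))
  ordered-moveToFront {ks = ks} d′j≢0 ordered =
    All.map (λ k≢j → k≢j ∘ sym , λ d′j≡0 → contradiction d′j≡0 d′j≢0) ≢j
    ∷ ordered-agree ≢j (AllPairs.filter⁺ (λ k → ¬? (k Fin.≟ j)) ordered)
    where
    ≢j = All.all-filter (λ k → ¬? (k Fin.≟ j)) ks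

module _ {n} (j : Fin n) (s : State n) where

  ∈-moveToFront⁺ : T s ⊆ T (moveToFront j s)
  ∈-moveToFront⁺ {k} k∈T with k Fin.≟ j
  ... | yes refl = here refl
  ... | no  k≢j  = there (∈-filter⁺ (λ k → ¬? (k Fin.≟ j)) k∈T k≢j)

  ∈-moveToFront⁻ : j ∈ T s → T (moveToFront j s) ⊆ T s
  ∈-moveToFront⁻ j∈T (here refl) = j∈T
  ∈-moveToFront⁻ j∈T (there k∈)  = proj₁ (∈-filter⁻ (λ k → ¬? (k Fin.≟ j)) k∈)

  -- Filtering out `j`, which occurs in the list, loses at least one element; this pays for the copy
  -- put in front.
  length-moveToFront : j ∈ T s → length (T (moveToFront j s)) ℕ.≤ length (T s)
  length-moveToFront j∈T = filter-notAll (λ k → ¬? (k Fin.≟ j)) (T s)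
    (Any.map (λ j≡k k≢j → k≢j (sym j≡k)) j∈T)

-- Proportionality to the real symmetrizer, and the loop invariant.

module Correctness {n} (A : Matrix ℤ n) (e : Fin n → ℕ → ℚ) (e>0 : ∀ i → EventuallyPositive (e i))
  (e-balance : ∀ i j → fromℤ (A i j) ∙ e i ≈ fromℤ (A j i) ∙ e j) where

  -- Cross-multiplied form of `p / e k = q / e l`, which avoids inverting a real number.
  Proportional : ℚ → Fin n → ℚ → Fin n → Set
  Proportional p k q l = p ∙ e l ≈ q ∙ e k

  proportional-trans : ∀ {p j r i q k} → r ≢ 0ℚ →
    Proportional p j r i → Proportional r i q k → Proportional p j q k
  proportional-trans {p} {j} {r} {i} {q} {k} r≢0 pi≈rj rk≈qi = ∙-cancel {p} {q} {r} {e k} {e j} r≢0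
    (≈-trans {(p * r) ∙ e k} {(p * q) ∙ e i} {(q * r) ∙ e j}
      (∙-scale p {r} {q} {e k} {e i} rk≈qi)
      (subst (λ z → z ∙ e i ≈ (q * r) ∙ e j) (*-comm q p) (∙-scale q {p} {r} {e i} {e j} pi≈rj)))

  -- Multiplying the proportion by `a` and applying `e-balance` turns both sides into multiples of
  -- `e l`, which is positive and cancels.
  proportional⇒balanced : ∀ {p k q l} → Proportional p k q l → p * fromℤ (A k l) ≡ q * fromℤ (A l k)
  proportional⇒balanced {p} {k} {q} {l} pl≈qk = ∙-injective {p * a} {q * b} {e l} (e>0 l)
    (≈-trans {(p * a) ∙ e l} {(q * a) ∙ e k} {(q * b) ∙ e l}
      (subst₂ (λ y z → y ∙ e l ≈ z ∙ e k) (*-comm a p) (*-comm a q) (∙-scale a {p} {q} {e l} {e k} pl≈qk))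
      (∙-scale q {a} {b} {e k} {e l} (e-balance k l)))
    where
    a = fromℤ (A k l)
    b = fromℤ (A l k)

  -- Justifies the assignment formula of the algorithm: `e-balance` scaled by `p` is this proportion
  -- multiplied by `b`, and `b` is nonzero.
  proportional-÷ : ∀ {p i j} (a≢0 : A j i ≢ 0ℤ) →
    Proportional (_÷_ (p * fromℤ (A i j)) (fromℤ (A j i)) {{fromℤ-nonZero a≢0}}) j p i
  proportional-÷ {p} {i} {j} a≢0 = ∙-cancel {(p * a) ÷ b} {p} {b} {e i} {e j} (λ b≡0 → a≢0 (cong ↥_ b≡0))
    (subst (λ z → z ∙ e i ≈ (p * b) ∙ e j) (sym ÷-*) (∙-scale p {a} {b} {e i} {e j} (e-balance i j)))
    where
    a = fromℤ (A i j)
    b = fromℤ (A j i)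
    instance _ = fromℤ-nonZero a≢0
    ÷-* : (p * a) ÷ b * b ≡ p * a
    ÷-* = trans (*-assoc (p * a) (1/ b) b) (trans (cong (p * a *_) (*-inverseˡ b)) (*-identityʳ (p * a)))

  -- Makes the nonzero pattern of `A` an undirected graph: if `A i j` vanishes, `b ∙ e j` tends to
  -- zero although `e j` is positive.
  zero-symmetric : ∀ {i j} → A i j ≡ 0ℤ → A j i ≡ 0ℤ
  zero-symmetric {i} {j} a≡0 = cong ↥_ (∙-injective {b} {0ℚ} {e j} (e>0 j)
    (≈-trans {b ∙ e j} {0ℚ ∙ e i} {0ℚ ∙ e j}
      (subst (λ z → b ∙ e j ≈ fromℤ z ∙ e i) a≡0 (e-balance j i))
      (≗⇒≈ {0ℚ ∙ e i} {0ℚ ∙ e j} λ m → trans (*-zeroˡ (e i m)) (sym (*-zeroˡ (e j m))))))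
    where
    b = fromℤ (A j i)

  Balanced : Vector ℚ n → Fin n → Fin n → Set
  Balanced d k l = d k * fromℤ (A k l) ≡ d l * fromℤ (A l k)

  -- U is T, together with the current index i during the pass from i.
  record Consistent (d : Vector ℚ n) (S : Subset n) (U : List (Fin n)) : Set where
    field
      sign         : ∀ k → d k ≡ 0ℚ ⊎ 0ℚ < d k
      S⇒zero       : ∀ {k} → k Subset.∈ S → d k ≡ 0ℚ
      zero⇒S       : ∀ {k} → d k ≡ 0ℚ → k Subset.∈ S
      zero⇒U       : ∀ {k} → d k ≡ 0ℚ → k ∈ U
      closed       : ∀ {l} → d l ≡ 0ℚ → ∀ k → k ∈ U ⊎ A l k ≡ 0ℤ
      -- Asked only inside `U`: each component of the graph starts from its own value 1 and so has
      -- its own factor relative to `e`.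
      proportional : ∀ {k l} → k ∈ U → l ∈ U → d k ≢ 0ℚ → d l ≢ 0ℚ → Proportional (d k) k (d l) l
      balanced     : ∀ {k l} → d k ≢ 0ℚ → d l ≢ 0ℚ → Balanced d k l

  open Consistent

  -- The invariant sees `U` only through membership, so reordering `T` preserves it.
  consistent-resp-⊆⊇ : ∀ {d S U V} → U ⊆ V → V ⊆ U → Consistent d S U → Consistent d S V
  consistent-resp-⊆⊇ U⊆V V⊆U c = record
    { sign         = sign c
    ; S⇒zero       = S⇒zero c
    ; zero⇒S       = zero⇒S c
    ; zero⇒U       = λ z → U⊆V (zero⇒U c z)
    ; closed       = λ z k → Sum.map₁ U⊆V (closed c z k)
    ; proportional = λ k∈V l∈V → proportional c (V⊆U k∈V) (V⊆U l∈V)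
    ; balanced     = balanced c
    }

  -- The point is balance between `j` and an assigned `k`. Since `j` was unassigned, `closed` leaves
  -- two cases: `k` lies in `U`, where the proportion gives balance, or `A j k` is zero and both
  -- sides vanish.
  consistent-update : ∀ {d d′ S U j} → Consistent d S U → d j ≡ 0ℚ → 0ℚ < d′ j → (∀ k → k ≢ j → d′ k ≡ d k) →
    (∀ {k} → k ∈ U → d k ≢ 0ℚ → Proportional (d′ j) j (d k) k) → Consistent d′ (S Subset.- j) U
  consistent-update {d} {d′} {S} {U} {j} c dj≡0 0<d′j agree fresh = record
    { sign         = λ k → sign′ k (k Fin.≟ j)
    ; S⇒zero       = λ {k} k∈ → S⇒zero′ (k Fin.≟ j) k∈
    ; zero⇒S       = λ z → x∈p∧x≢y⇒x∈p-y (zero⇒S c (unset z)) (zero-≢ z)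
    ; zero⇒U       = λ z → zero⇒U c (unset z)
    ; closed       = λ z → closed c (unset z)
    ; proportional = λ {k} {l} → proportional′ (k Fin.≟ j) (l Fin.≟ j)
    ; balanced     = λ {k} {l} → balanced′ (k Fin.≟ j) (l Fin.≟ j)
    }
    where
    zero-≢ : ∀ {k} → d′ k ≡ 0ℚ → k ≢ j
    zero-≢ z refl = <⇒≢ 0<d′j (sym z)
    unset : ∀ {k} → d′ k ≡ 0ℚ → d k ≡ 0ℚ
    unset {k} z = trans (sym (agree k (zero-≢ z))) z
    nonzero : ∀ {k} → k ≢ j → d′ k ≢ 0ℚ → d k ≢ 0ℚ
    nonzero {k} k≢j d′k≢0 z = d′k≢0 (trans (agree k k≢j) z)
    sign′ : ∀ k → Dec (k ≡ j) → d′ k ≡ 0ℚ ⊎ 0ℚ < d′ k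
    sign′ k (yes refl) = inj₂ 0<d′j
    sign′ k (no  k≢j)  = subst (λ q → q ≡ 0ℚ ⊎ 0ℚ < q) (sym (agree k k≢j)) (sign c k)
    S⇒zero′ : ∀ {k} → Dec (k ≡ j) → k Subset.∈ S Subset.- j → d′ k ≡ 0ℚ
    S⇒zero′     (yes refl) j∈ = contradiction j∈ (x∉p-x S j)
    S⇒zero′ {k} (no  k≢j)  k∈ = trans (agree k k≢j) (S⇒zero c (p─q⊆p S Subset.⁅ j ⁆ k∈))
    fresh′ : ∀ {k} → k ≢ j → k ∈ U → d′ k ≢ 0ℚ → Proportional (d′ j) j (d′ k) k
    fresh′ {k} k≢j k∈U d′k≢0 = subst (λ q → Proportional (d′ j) j q k) (sym (agree k k≢j))
      (fresh k∈U (nonzero k≢j d′k≢0))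
    proportional′ : ∀ {k l} → Dec (k ≡ j) → Dec (l ≡ j) → k ∈ U → l ∈ U → d′ k ≢ 0ℚ → d′ l ≢ 0ℚ →
                    Proportional (d′ k) k (d′ l) l
    proportional′ (yes refl) (yes refl) _ _ _ _ = ≗⇒≈ {d′ j ∙ e j} {d′ j ∙ e j} λ _ → refl
    proportional′ (yes refl) (no l≢j) _ l∈U _ d′l≢0 = fresh′ l≢j l∈U d′l≢0
    proportional′ {k} (no k≢j) (yes refl) k∈U _ d′k≢0 _ =
      ≈-sym {d′ j ∙ e k} {d′ k ∙ e j} (fresh′ k≢j k∈U d′k≢0)
    proportional′ {k} {l} (no k≢j) (no l≢j) k∈U l∈U d′k≢0 d′l≢0 =
      subst₂ (λ p q → Proportional p k q l) (sym (agree k k≢j)) (sym (agree l l≢j))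
        (proportional c k∈U l∈U (nonzero k≢j d′k≢0) (nonzero l≢j d′l≢0))
    cross : ∀ {k} → k ≢ j → d′ k ≢ 0ℚ → k ∈ U ⊎ A j k ≡ 0ℤ → Balanced d′ j k
    cross {k} k≢j d′k≢0 (inj₁ k∈U) = proportional⇒balanced {d′ j} {j} {d′ k} {k} (fresh′ k≢j k∈U d′k≢0)
    cross {k} k≢j d′k≢0 (inj₂ a≡0) = trans
      (trans (cong (λ a → d′ j * fromℤ a) a≡0) (*-zeroʳ (d′ j)))
      (sym (trans (cong (λ a → d′ k * fromℤ a) (zero-symmetric a≡0)) (*-zeroʳ (d′ k))))
    balanced′ : ∀ {k l} → Dec (k ≡ j) → Dec (l ≡ j) → d′ k ≢ 0ℚ → d′ l ≢ 0ℚ → Balanced d′ k l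
    balanced′ (yes refl) (yes refl) _ _ = refl
    balanced′ {l = l} (yes refl) (no l≢j) _ d′l≢0 = cross l≢j d′l≢0 (closed c dj≡0 l)
    balanced′ {k} (no k≢j) (yes refl) d′k≢0 _ = sym (cross k≢j d′k≢0 (closed c dj≡0 k))
    balanced′ {k} {l} (no k≢j) (no l≢j) d′k≢0 d′l≢0 =
      subst₂ (λ p q → p * fromℤ (A k l) ≡ q * fromℤ (A l k)) (sym (agree k k≢j)) (sym (agree l l≢j))
        (balanced c (nonzero k≢j d′k≢0) (nonzero l≢j d′l≢0))

  -- js are the indices still to be visited in the pass from i; the bound on the length
  -- of T is the termination measure.
  record Scanning (bound : ℕ) (i : Fin n) (js : List (Fin n)) (s : State n) : Set where
    field
      consistent : Consistent (d s) (S s) (i ∷ T s)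
      ordered    : Ordered (d s) (T s)
      head≢0     : d s i ≢ 0ℚ
      pending    : ∀ {l} → d s l ≡ 0ℚ → A l i ≡ 0ℤ ⊎ l ∈ js
      js⊆T       : js ⊆ T s
      length≤    : length (T s) ℕ.≤ bound

  open Scanning

  -- Preservation of the invariant within one pass.

  head-scanning : ∀ {d S i T′} → Consistent d S (i ∷ T′) → Ordered d (i ∷ T′) →
    Scanning (length T′) i T′ (assignIfZero i 1ℚ ⟨ d , S , T′ ⟩)
  head-scanning {d} {S} {i} {T′} c (i<T′ ∷ o) =
    assignIfZero-elim (Scanning (length T′) i T′) i 1ℚ ⟨ d , S , T′ ⟩ keep set
    where
    scanning : ∀ {d S} → Consistent d S (i ∷ T′) → Ordered d T′ → d i ≢ 0ℚ →
               Scanning (length T′) i T′ ⟨ d , S , T′ ⟩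
    scanning {d} c o di≢0 = record
      { consistent = c
      ; ordered    = o
      ; head≢0     = di≢0
      ; pending    = λ z → inj₂ (Any.tail (λ { refl → di≢0 z }) (zero⇒U c z))
      ; js⊆T       = λ k∈ → k∈
      ; length≤    = ℕ.≤-refl
      }
    keep : d i ≢ 0ℚ → Scanning (length T′) i T′ ⟨ d , S , T′ ⟩
    keep = scanning c o
    set : d i ≡ 0ℚ → Scanning (length T′) i T′ (assign i 1ℚ ⟨ d , S , T′ ⟩)
    set di≡0 = scanning
      -- By the ordering, an unassigned head means that all of `T′` is unassigned, so the value 1
      -- has nothing in `U` to be proportional to.
      (consistent-update c di≡0 (subst (0ℚ <_) (sym d′i≡1) (positive⁻¹ 1ℚ)) agree
        λ k∈ dk≢0 → contradiction (all-zero k∈) dk≢0)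
      (ordered-agree agree (All.map (λ { (i≢k , _) k≡i → i≢k (sym k≡i) }) i<T′) o)
      λ z → <⇒≢ (positive⁻¹ 1ℚ) (trans (sym z) d′i≡1)
      where
      d′i≡1 : updateAt d i (const 1ℚ) i ≡ 1ℚ
      d′i≡1 = updateAt-updates i d
      agree : ∀ k → k ≢ i → updateAt d i (const 1ℚ) k ≡ d k
      agree k = updateAt-minimal k i d
      all-zero : ∀ {k} → k ∈ i ∷ T′ → d k ≡ 0ℚ
      all-zero (here refl)  = di≡0
      all-zero (there k∈T′) = proj₂ (All.lookup i<T′ k∈T′) di≡0

  visit-scanning : ∀ {b i j js s} → Scanning b i (j ∷ js) s → Scanning b i js (visit A i s j)
  visit-scanning {b} {i} {j} {js} {s} sc = visit-elim A (Scanning b i js) i s j skip move set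
    where
    j∈T : j ∈ T s
    j∈T = js⊆T sc (here refl)
    T⁺ : T s ⊆ T (moveToFront j s)
    T⁺ = ∈-moveToFront⁺ j s
    T⁻ : T (moveToFront j s) ⊆ T s
    T⁻ = ∈-moveToFront⁻ j s j∈T
    moved : Consistent (d s) (S s) (i ∷ T (moveToFront j s))
    moved = consistent-resp-⊆⊇ (∷⁺ʳ i T⁺) (∷⁺ʳ i T⁻) (consistent sc)
    skip : A j i ≡ 0ℤ → Scanning b i js s
    skip a≡0 = record
      { consistent = consistent sc
      ; ordered    = ordered sc
      ; head≢0     = head≢0 sc
      ; pending    = λ z → done (pending sc z)
      ; js⊆T       = js⊆T sc ∘ there
      ; length≤    = length≤ sc
      }
      where
      done : ∀ {l} → A l i ≡ 0ℤ ⊎ l ∈ j ∷ js → A l i ≡ 0ℤ ⊎ l ∈ js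
      done (inj₁ a≡0)          = inj₁ a≡0
      done (inj₂ (here refl))  = inj₁ a≡0
      done (inj₂ (there l∈js)) = inj₂ l∈js
    move : A j i ≢ 0ℤ → d s j ≢ 0ℚ → Scanning b i js (moveToFront j s)
    move _ dj≢0 = record
      { consistent = moved
      ; ordered    = ordered-moveToFront (λ _ _ → refl) {S = S s} dj≢0 (ordered sc)
      ; head≢0     = head≢0 sc
      ; pending    = λ z → Sum.map₂ (Any.tail λ { refl → dj≢0 z }) (pending sc z)
      ; js⊆T       = T⁺ ∘ js⊆T sc ∘ there
      ; length≤    = ℕ.≤-trans (length-moveToFront j s j∈T) (length≤ sc)
      }
    set : (a≢0 : A j i ≢ 0ℤ) → d s j ≡ 0ℚ → Scanning b i js
      (assign j (_÷_ (d s i * fromℤ (A i j)) (fromℤ (A j i)) {{fromℤ-nonZero a≢0}}) (moveToFront j s))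
    set a≢0 dj≡0 = record
      -- The new entry is proportional to that of `i` by its formula, hence by transitivity to every
      -- assigned entry of `U`; for this `i` is kept in `U` during its pass.
      { consistent = consistent-update moved dj≡0 0<d′j agree λ {k} k∈ dk≢0 →
          subst (λ p → Proportional p j (d s k) k) (sym d′j≡q)
            (proportional-trans {q} {j} {d s i} {i} {d s k} {k} (head≢0 sc) q∝di
              (proportional moved (here refl) k∈ (head≢0 sc) dk≢0))
      ; ordered    = ordered-moveToFront agree {S = S s} d′j≢0 (ordered sc)
      ; head≢0     = λ z → head≢0 sc (unset z)
      ; pending    = λ z → Sum.map₂ (Any.tail λ { refl → d′j≢0 z }) (pending sc (unset z))
      ; js⊆T       = T⁺ ∘ js⊆T sc ∘ there
      ; length≤    = ℕ.≤-trans (length-moveToFront j s j∈T) (length≤ sc)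
      }
      where
      q : ℚ
      q = _÷_ (d s i * fromℤ (A i j)) (fromℤ (A j i)) {{fromℤ-nonZero a≢0}}
      d′ : Vector ℚ n
      d′ = updateAt (d s) j (const q)
      d′j≡q : d′ j ≡ q
      d′j≡q = updateAt-updates j (d s)
      agree : ∀ k → k ≢ j → d′ k ≡ d s k
      agree k = updateAt-minimal k j (d s)
      q∝di : Proportional q j (d s i) i
      q∝di = proportional-÷ {d s i} {i} {j} a≢0
      0<di : 0ℚ < d s i
      0<di = Sum.fromInj₂ (λ z → contradiction z (head≢0 sc)) (sign moved i)
      0<d′j : 0ℚ < d′ j
      -- The sign of the quotient is read off its proportion to `d s i`, not off the integers
      -- `A i j` and `A j i`.
      0<d′j = subst (0ℚ <_) (sym d′j≡q) (∙-pos {q} {d s i} {e i} {e j} (e>0 i) (e>0 j) q∝di 0<di)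
      d′j≢0 : d′ j ≢ 0ℚ
      d′j≢0 z = <⇒≢ 0<d′j (sym z)
      unset : ∀ {k} → d′ k ≡ 0ℚ → d s k ≡ 0ℚ
      unset {k} z = trans (sym (agree k λ { refl → d′j≢0 z })) z

  -- From the inner loop to the complete run.

  scan : ∀ {b i} js {s} → Scanning b i js s → Scanning b i [] (foldl (visit A i) s js)
  scan []       sc = sc
  scan (j ∷ js) sc = scan js (visit-scanning sc)

  -- Once nothing is left to visit, `pending` says that `i` has no unassigned neighbour, so `i` can
  -- leave `U` without breaking `closed`.
  scanned-consistent : ∀ {b i s} → Scanning b i [] s → Consistent (d s) (S s) (T s)
  scanned-consistent {i = i} {s} sc = record
    { sign         = sign c
    ; S⇒zero       = S⇒zero c
    ; zero⇒S       = zero⇒S c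
    ; zero⇒U       = λ z → Any.tail (λ { refl → head≢0 sc z }) (zero⇒U c z)
    ; closed       = λ z k → drop-head z (closed c z k)
    ; proportional = λ k∈ l∈ → proportional c (there k∈) (there l∈)
    ; balanced     = balanced c
    }
    where
    c = consistent sc
    drop-head : ∀ {k l} → d s l ≡ 0ℚ → k ∈ i ∷ T s ⊎ A l k ≡ 0ℤ → k ∈ T s ⊎ A l k ≡ 0ℤ
    drop-head z (inj₁ (here refl)) = inj₂ (Sum.fromInj₁ (λ ()) (pending sc z))
    drop-head z (inj₁ (there k∈))  = inj₁ k∈
    drop-head z (inj₂ a≡0)         = inj₂ a≡0

  terminates : ∀ b s → length (T s) ℕ.≤ b → Consistent (d s) (S s) (T s) → Ordered (d s) (T s) →
    Dec (Subset.Nonempty (S s)) →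
    ∃[ D ] ((A ⊢ s ⇓ Mℚ.diag D) × (∀ i → 0ℚ < D i) × (∀ i j → Balanced D i j))
  terminates b s _ c _ (no empty) = d s , stop empty
    , (λ i → Sum.fromInj₂ (λ z → contradiction z nonzero) (sign c i))
    , λ i j → balanced c nonzero nonzero
    where
    nonzero : ∀ {i} → d s i ≢ 0ℚ
    nonzero z = empty (_ , zero⇒S c z)
  -- The loop cannot get stuck: an index in `S` is unassigned and therefore still in `T`.
  terminates _ ⟨ d , S , [] ⟩ _ c _ (yes (_ , k∈S)) = contradiction (zero⇒U c (S⇒zero c k∈S)) λ ()
  terminates (ℕ.suc b) ⟨ d , S , i ∷ T′ ⟩ (ℕ.s≤s len) c o (yes nonempty) =
    let sc = scan T′ (head-scanning c o)
        D , run , correct = terminates b _ (ℕ.≤-trans (length≤ sc) len)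
                              (scanned-consistent sc) (ordered sc) (nonempty? _)
    in D , loop nonempty refl run , correct

  initial-consistent : Consistent (d (initial n)) (S (initial n)) (T (initial n))
  initial-consistent = record
    { sign         = λ _ → inj₁ refl
    ; S⇒zero       = λ _ → refl
    ; zero⇒S       = λ _ → ∈⊤
    ; zero⇒U       = λ {k} _ → ∈-allFin k
    ; closed       = λ _ k → inj₁ (∈-allFin k)
    ; proportional = λ _ _ dk≢0 → contradiction refl dk≢0
    ; balanced     = λ dk≢0 → contradiction refl dk≢0
    }

  initial-ordered : Ordered (d (initial n)) (T (initial n))
  initial-ordered = AllPairs.map (λ k≢l → k≢l , λ _ → refl) (allFin⁺ n)

proposition3p4 : (n : ℕ) .{{_ : NonZero n}} (A : Matrix ℤ n) → Symmetrizable A →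
    ∃[ d ] ((SymmetrizerMatrix A returns Mℚ.diag d) × (∀ i → 0ℚ < d i) × Mℚ.IsSymmetric (Mℚ.diag d Mℚ.⊗ map (map fromℤ) A))
proposition3p4 n A (e , e>0 , symmetric) =
  let d , run , d>0 , bal = terminates n (initial n) (ℕ.≤-reflexive (length-tabulate (λ i → i)))
                              initial-consistent initial-ordered (nonempty? _)
  in d , run , d>0 , λ i j →
       trans (diag-⊗ d (map (map fromℤ) A) i j) (trans (bal i j) (sym (diag-⊗ d (map (map fromℤ) A) j i)))
  where
  open Correctness A (λ i → seq (e i)) e>0 (balance A e (Mℝ.diag e) (map (map fromℤᴿ) A) refl refl symmetric)
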